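{- Let $S_{\mathbb{N}}$ be the set of magic labellings of the cube, i.e. the set of $\alpha=(x_1,\dots,x_{12})\in\mathbb{N}^{12}$ for which there is $r\in\mathbb{N}$ with $x_1+x_2+x_9=r$, $x_1+x_3+x_{10}=r$, $x_2+x_4+x_{12}=r$, $x_3+x_4+x_{11}=r$, $x_5+x_6+x_9=r$, $x_5+x_7+x_{10}=r$, $x_6+x_8+x_{12}=r$, $x_7+x_8+x_{11}=r$. Let $e_1,\dots,e_{12}$ be the standard unit vectors of $\mathbb{N}^{12}$ and put $\alpha_1=e_2+e_3+e_5+e_8$, $\alpha_2=e_1+e_4+e_6+e_7$, $\alpha_3=e_1+e_5+e_{11}+e_{12}$, $\alpha_4=e_2+e_6+e_{10}+e_{11}$, $\alpha_5=e_1+e_4+e_5+e_8$, $\alpha_6=e_4+e_8+e_9+e_{10}$, $\alpha_7=e_3+e_7+e_9+e_{12}$, $\alpha_8=e_2+e_3+e_6+e_7$, $\alpha_9=e_9+e_{10}+e_{11}+e_{12}$, and $T=\sum_{i=1}^{12}e_i$. Then every $\alpha\in S_{\mathbb{N}}$ can be written uniquely in one of the following eight types, where $k_1,\dots,k_6\in\mathbb{N}$: (t1) $k_1\alpha_1+k_2\alpha_2+k_3\alpha_3+k_4\alpha_4+k_5\alpha_5+k_6\alpha_6$; (t2) $\alpha_7+k_1\alpha_1+k_2\alpha_2+k_3\alpha_3+k_4\alpha_5+k_5\alpha_6+k_6\alpha_7$; (t31) $\alpha_9+k_1\alpha_2+k_2\alpha_3+k_3\alpha_4+k_4\alpha_6+k_5\alpha_7+k_6\alpha_9$;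 (t32) $(\alpha_1+\alpha_9)+k_1\alpha_1+k_2\alpha_3+k_3\alpha_4+k_4\alpha_6+k_5\alpha_7+k_6\alpha_9$; (t33) $(\alpha_6+\alpha_8)+k_1\alpha_1+k_2\alpha_2+k_3\alpha_4+k_4\alpha_6+k_5\alpha_7+k_6\alpha_8$; (t34) $\alpha_8+k_1\alpha_1+k_2\alpha_2+k_3\alpha_3+k_4\alpha_4+k_5\alpha_7+k_6\alpha_8$; (t351) $(\alpha_4+\alpha_7)+k_1\alpha_1+k_2\alpha_2+k_3\alpha_3+k_4\alpha_4+k_5\alpha_6+k_6\alpha_7$; (t352) $T+k_1\alpha_1+k_2\alpha_2+k_3\alpha_3+k_4\alpha_4+k_5\alpha_6+k_6\alpha_7$. That is, for each $\alpha\in S_{\mathbb{N}}$ there is exactly one type and exactly one tuple $(k_1,\dots,k_6)\in\mathbb{N}^6$ for which $\alpha$ equals the corresponding expression.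
   Context: The cube graph has 8 vertices and 12 edges numbered $1,\dots,12$; the eight vertices are incident to the edge sets $\{1,2,9\},\{1,3,10\},\{2,4,12\},\{3,4,11\},\{5,6,9\},\{5,7,10\},\{6,8,12\},\{7,8,11\}$. A labelling assigns $x_i\in\mathbb{N}$ to edge $i$; it is magic with magic sum $r$ if for every vertex the sum of the labels of the three incident edges equals $r$. $\mathbb{N}=\{0,1,2,\dots\}$. -}

module Defs where

open import Data.Nat using (ℕ; zero; suc; _+_; _*_)
open import Data.Fin using (Fin; zero; suc)
open import Data.Vec using (Vec; []; _∷_; lookup; replicate; zipWith; map; tabulate)
open import Data.Product using (Σ; ∃; _×_; _,_)
open import Relation.Binary.PropositionalEquality using (_≡_)

-- Labellings of the 12 cube edges: edge i (1-based in the paper) is index i-1.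
Labelling : Set
Labelling = Vec ℕ 12

_!_ : Labelling → Fin 12 → ℕ
α ! i = lookup α i

IsMagicWith : Labelling → ℕ → Set
IsMagicWith (x1 ∷ x2 ∷ x3 ∷ x4 ∷ x5 ∷ x6 ∷ x7 ∷ x8 ∷ x9 ∷ x10 ∷ x11 ∷ x12 ∷ []) r =
  (x1 + x2 + x9 ≡ r) × (x1 + x3 + x10 ≡ r) × (x2 + x4 + x12 ≡ r) × (x3 + x4 + x11 ≡ r) ×
  (x5 + x6 + x9 ≡ r) × (x5 + x7 + x10 ≡ r) × (x6 + x8 + x12 ≡ r) × (x7 + x8 + x11 ≡ r)

IsMagic : Labelling → Set
IsMagic α = ∃ λ r → IsMagicWith α r

_⊕_ : Labelling → Labelling → Labelling
_⊕_ = zipWith _+_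
infixl 6 _⊕_

_⊙_ : ℕ → Labelling → Labelling
k ⊙ v = map (k *_) v
infixl 7 _⊙_

𝟘 : Labelling
𝟘 = replicate 12 0

-- e i for i = 1..12 given as the 0-based Fin index (i-1)
e : Fin 12 → Labelling
e i = tabulate λ j → δ i j
  where
  δ : {n : ℕ} → Fin n → Fin n → ℕ
  δ zero zero = 1
  δ zero (suc _) = 0
  δ (suc _) zero = 0
  δ (suc a) (suc b) = δ a b

e₁ e₂ e₃ e₄ e₅ e₆ e₇ e₈ e₉ e₁₀ e₁₁ e₁₂ : Labelling
e₁ = e zero
e₂ = e (suc zero)
e₃ = e (suc (suc zero))
e₄ = e (suc (suc (suc zero)))
e₅ = e (suc (suc (suc (suc zero))))
e₆ = e (suc (suc (suc (suc (suc zero)))))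
e₇ = e (suc (suc (suc (suc (suc (suc zero))))))
e₈ = e (suc (suc (suc (suc (suc (suc (suc zero)))))))
e₉ = e (suc (suc (suc (suc (suc (suc (suc (suc zero))))))))
e₁₀ = e (suc (suc (suc (suc (suc (suc (suc (suc (suc zero)))))))))
e₁₁ = e (suc (suc (suc (suc (suc (suc (suc (suc (suc (suc zero))))))))))
e₁₂ = e (suc (suc (suc (suc (suc (suc (suc (suc (suc (suc (suc zero)))))))))))

α₁ α₂ α₃ α₄ α₅ α₆ α₇ α₈ α₉ T : Labelling
α₁ = e₂ ⊕ e₃ ⊕ e₅ ⊕ e₈
α₂ = e₁ ⊕ e₄ ⊕ e₆ ⊕ e₇
α₃ = e₁ ⊕ e₅ ⊕ e₁₁ ⊕ e₁₂
α₄ = e₂ ⊕ e₆ ⊕ e₁₀ ⊕ e₁₁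
α₅ = e₁ ⊕ e₄ ⊕ e₅ ⊕ e₈
α₆ = e₄ ⊕ e₈ ⊕ e₉ ⊕ e₁₀
α₇ = e₃ ⊕ e₇ ⊕ e₉ ⊕ e₁₂
α₈ = e₂ ⊕ e₃ ⊕ e₆ ⊕ e₇
α₉ = e₉ ⊕ e₁₀ ⊕ e₁₁ ⊕ e₁₂
T = e₁ ⊕ e₂ ⊕ e₃ ⊕ e₄ ⊕ e₅ ⊕ e₆ ⊕ e₇ ⊕ e₈ ⊕ e₉ ⊕ e₁₀ ⊕ e₁₁ ⊕ e₁₂

data Type : Set where
  t1 t2 t31 t32 t33 t34 t351 t352 : Type

base : Type → Labelling
base t1 = 𝟘
base t2 = α₇
base t31 = α₉
base t32 = α₁ ⊕ α₉
base t33 = α₆ ⊕ α₈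
base t34 = α₈
base t351 = α₄ ⊕ α₇
base t352 = T

gens : Type → Vec Labelling 6
gens t1 = α₁ ∷ α₂ ∷ α₃ ∷ α₄ ∷ α₅ ∷ α₆ ∷ []
gens t2 = α₁ ∷ α₂ ∷ α₃ ∷ α₅ ∷ α₆ ∷ α₇ ∷ []
gens t31 = α₂ ∷ α₃ ∷ α₄ ∷ α₆ ∷ α₇ ∷ α₉ ∷ []
gens t32 = α₁ ∷ α₃ ∷ α₄ ∷ α₆ ∷ α₇ ∷ α₉ ∷ []
gens t33 = α₁ ∷ α₂ ∷ α₄ ∷ α₆ ∷ α₇ ∷ α₈ ∷ []
gens t34 = α₁ ∷ α₂ ∷ α₃ ∷ α₄ ∷ α₇ ∷ α₈ ∷ []
gens t351 = α₁ ∷ α₂ ∷ α₃ ∷ α₄ ∷ α₆ ∷ α₇ ∷ []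
gens t352 = α₁ ∷ α₂ ∷ α₃ ∷ α₄ ∷ α₆ ∷ α₇ ∷ []

expr : Type → Vec ℕ 6 → Labelling
expr t (k1 ∷ k2 ∷ k3 ∷ k4 ∷ k5 ∷ k6 ∷ []) with gens t
... | g1 ∷ g2 ∷ g3 ∷ g4 ∷ g5 ∷ g6 ∷ [] =
  base t ⊕ k1 ⊙ g1 ⊕ k2 ⊙ g2 ⊕ k3 ⊙ g3 ⊕ k4 ⊙ g4 ⊕ k5 ⊙ g5 ⊕ k6 ⊙ g6

{-# OPTIONS --safe #-}

-- A magic labelling is determined by p = x₃, q = x₇, r = x₁₂, s = x₉ and the integers
-- u = x₂ − x₃ = x₆ − x₇ = x₁₀ − x₉ = x₁₁ − x₁₂ and
-- v = x₁ − q − r = x₄ − q − s = x₅ − p − r = x₈ − p − s.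
-- In these coordinates the magic labellings are the lattice points with
-- u ≥ −min(p,q,r,s) and v ≥ −(min(p,q) + min(r,s)), and the types are the regions
--   t1         u ≥ 0, v ≥ 0
--   t2         u < 0, v ≥ 2u
--   t31, t32   v < −2 min(p,q), with p ≤ q, resp. q < p
--   t34, t33   v < −2 min(r,s), with s ≤ r, resp. r < s
--   t351, t352 −2 min(p,q,r,s) ≤ v < min(0,2u), with v even, resp. odd.
-- Uniqueness follows by recovering the type and then the coefficients from the labels.
module Submission where

open import Defs
open import Data.Empty using (⊥)
open import Data.Nat using (ℕ; zero; suc; _+_; _*_; _∸_; _≤_; _<_; z≤n; s≤s; s≤s⁻¹; ⌊_/2⌋; _≤?_; _<?_)
open import Data.Nat.Divisibility using (_∣_; _∣?_; divides; ∣1⇒≡1; ∣m+n∣m⇒∣n)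
open import Data.Nat.Properties
open import Data.Nat.Tactic.RingSolver using (solve)
open import Data.Product using (Σ; ∃; ∃₂; _×_; _,_)
open import Data.Sum using (_⊎_; inj₁; inj₂; [_,_]′)
open import Data.Vec using (Vec; []; _∷_; zipWith; map; toList)
open import Relation.Binary.PropositionalEquality using (_≡_; refl; sym; trans; cong; cong₂; subst)
open import Relation.Nullary using (Dec; yes; no; ¬_; contradiction)
open import Relation.Nullary.Decidable using (_⊎-dec_)

-- Linear arithmetic over ℕ

infixl 5 _⊞_
_⊞_ : ∀ {a b c d : ℕ} → a ≡ b → c ≡ d → a + c ≡ b + d
_⊞_ = cong₂ _+_

-- The second hypothesis is the subtraction-free form of a − b = r − l.
≡-by : ∀ {a b l r} → l ≡ r → a + l ≡ b + r → a ≡ b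
≡-by {a} {b} {l} refl eq = +-cancelʳ-≡ l a b eq

-- The strict analogue of `≡-by`: the last hypothesis is the subtraction-free form of b - a = (d -
-- c) + (l - r).
<-by : ∀ a b {c d l r} → c < d → l ≡ r → a + d + l ≡ b + c + r → a < b
<-by a b {c} {d} {l} c<d refl eq = +-cancelʳ-< c a b
  (subst (a + c <_) (+-cancelʳ-≡ l (a + d) (b + c) eq) (+-monoʳ-< a c<d))

≤-by : ∀ {a b} d → b ≡ a + d → a ≤ b
≤-by {a} d refl = m≤m+n a d

-- The excess `d` is passed explicitly, so that only an equation is left to prove.
≤-absurd : ∀ {a b} → a ≤ b → ∀ d → a ≡ suc b + d → ⊥
≤-absurd a≤b d eq = contradiction a≤b (<⇒≱ (≤-by d eq))

∸-by : ∀ {a} b {d} → a ≡ b + d → a ∸ b ≡ d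
∸-by b {d} refl = m+n∸m≡n b d

half-≤ : ∀ {m n} → m + m ≤ n + n → m ≤ n
half-≤ m+m≤n+n = ≮⇒≥ λ n<m → <⇒≱ (+-mono-< n<m n<m) m+m≤n+n

half-< : ∀ {m n} → m + m < n + n → m < n
half-< m+m<n+n = ≰⇒> λ n≤m → <⇒≱ m+m<n+n (+-mono-≤ n≤m n≤m)

even⊎odd : ∀ n → ∃ λ m → n ≡ m + m ⊎ n ≡ suc (m + m)
even⊎odd zero = 0 , inj₁ refl
even⊎odd (suc n) with even⊎odd n
... | m , inj₁ eq = m , inj₂ (cong suc eq)
... | m , inj₂ eq = suc m , inj₁ (cong suc (trans eq (sym (+-suc m m))))

-- The labels of each type

-- a + k * c, but reducing at the literals c = 0 and c = 1, so that expr t k computes to label t k.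
scale-add : ℕ → ℕ → ℕ → ℕ
scale-add k a 0 = a
scale-add k a 1 = a + k
scale-add k a c = a + k * c

scale-add-correct : ∀ k a c → a + k * c ≡ scale-add k a c
scale-add-correct k a 0 = trans (cong (a +_) (*-zeroʳ k)) (+-identityʳ a)
scale-add-correct k a 1 = cong (a +_) (*-identityʳ k)
scale-add-correct k a (suc (suc c)) = refl

⊕⊙-scale-add : ∀ {n} k (v g : Vec ℕ n) → zipWith _+_ v (map (k *_) g) ≡ zipWith (scale-add k) v g
⊕⊙-scale-add k [] [] = refl
⊕⊙-scale-add k (a ∷ v) (c ∷ g) = cong₂ _∷_ (scale-add-correct k a c) (⊕⊙-scale-add k v g)

combination : ∀ b g1 g2 g3 g4 g5 g6 k1 k2 k3 k4 k5 k6 →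
  b ⊕ k1 ⊙ g1 ⊕ k2 ⊙ g2 ⊕ k3 ⊙ g3 ⊕ k4 ⊙ g4 ⊕ k5 ⊙ g5 ⊕ k6 ⊙ g6 ≡
  zipWith (scale-add k6) (zipWith (scale-add k5) (zipWith (scale-add k4)
    (zipWith (scale-add k3) (zipWith (scale-add k2) (zipWith (scale-add k1) b g1) g2) g3) g4) g5) g6
combination b g1 g2 g3 g4 g5 g6 k1 k2 k3 k4 k5 k6 =
  step k6 g6 (step k5 g5 (step k4 g4 (step k3 g3 (step k2 g2 (step k1 g1 refl)))))
  where
  step : ∀ k g {v w} → v ≡ w → v ⊕ k ⊙ g ≡ zipWith (scale-add k) w g
  step k g {v} refl = ⊕⊙-scale-add k v g

-- The order of the summands is the one to which the right-hand side of `combination` computes;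
-- `expr≡label` relies on this definitional equality.
label : Type → Vec ℕ 6 → Labelling
label t1 (k1 ∷ k2 ∷ k3 ∷ k4 ∷ k5 ∷ k6 ∷ []) =
  (k2 + k3 + k5) ∷ (k1 + k4) ∷ k1 ∷ (k2 + k5 + k6) ∷ (k1 + k3 + k5) ∷ (k2 + k4) ∷
  k2 ∷ (k1 + k5 + k6) ∷ k6 ∷ (k4 + k6) ∷ (k3 + k4) ∷ k3 ∷ []
label t2 (k1 ∷ k2 ∷ k3 ∷ k4 ∷ k5 ∷ k6 ∷ []) =
  (k2 + k3 + k4) ∷ k1 ∷ (1 + k1 + k6) ∷ (k2 + k4 + k5) ∷ (k1 + k3 + k4) ∷ k2 ∷
  (1 + k2 + k6) ∷ (k1 + k4 + k5) ∷ (1 + k5 + k6) ∷ k5 ∷ k3 ∷ (1 + k3 + k6) ∷ []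
label t31 (k1 ∷ k2 ∷ k3 ∷ k4 ∷ k5 ∷ k6 ∷ []) =
  (k1 + k2) ∷ k3 ∷ k5 ∷ (k1 + k4) ∷ k2 ∷ (k1 + k3) ∷
  (k1 + k5) ∷ k4 ∷ (1 + k4 + k5 + k6) ∷ (1 + k3 + k4 + k6) ∷ (1 + k2 + k3 + k6) ∷ (1 + k2 + k5 + k6) ∷ []
label t32 (k1 ∷ k2 ∷ k3 ∷ k4 ∷ k5 ∷ k6 ∷ []) =
  k2 ∷ (1 + k1 + k3) ∷ (1 + k1 + k5) ∷ k4 ∷ (1 + k1 + k2) ∷ k3 ∷
  k5 ∷ (1 + k1 + k4) ∷ (1 + k4 + k5 + k6) ∷ (1 + k3 + k4 + k6) ∷ (1 + k2 + k3 + k6) ∷ (1 + k2 + k5 + k6) ∷ []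
label t33 (k1 ∷ k2 ∷ k3 ∷ k4 ∷ k5 ∷ k6 ∷ []) =
  k2 ∷ (1 + k1 + k3 + k6) ∷ (1 + k1 + k5 + k6) ∷ (1 + k2 + k4) ∷ k1 ∷ (1 + k2 + k3 + k6) ∷
  (1 + k2 + k5 + k6) ∷ (1 + k1 + k4) ∷ (1 + k4 + k5) ∷ (1 + k3 + k4) ∷ k3 ∷ k5 ∷ []
label t34 (k1 ∷ k2 ∷ k3 ∷ k4 ∷ k5 ∷ k6 ∷ []) =
  (k2 + k3) ∷ (1 + k1 + k4 + k6) ∷ (1 + k1 + k5 + k6) ∷ k2 ∷ (k1 + k3) ∷ (1 + k2 + k4 + k6) ∷
  (1 + k2 + k5 + k6) ∷ k1 ∷ k5 ∷ k4 ∷ (k3 + k4) ∷ (k3 + k5) ∷ []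
label t351 (k1 ∷ k2 ∷ k3 ∷ k4 ∷ k5 ∷ k6 ∷ []) =
  (k2 + k3) ∷ (1 + k1 + k4) ∷ (1 + k1 + k6) ∷ (k2 + k5) ∷ (k1 + k3) ∷ (1 + k2 + k4) ∷
  (1 + k2 + k6) ∷ (k1 + k5) ∷ (1 + k5 + k6) ∷ (1 + k4 + k5) ∷ (1 + k3 + k4) ∷ (1 + k3 + k6) ∷ []
label t352 (k1 ∷ k2 ∷ k3 ∷ k4 ∷ k5 ∷ k6 ∷ []) =
  (1 + k2 + k3) ∷ (1 + k1 + k4) ∷ (1 + k1 + k6) ∷ (1 + k2 + k5) ∷ (1 + k1 + k3) ∷ (1 + k2 + k4) ∷
  (1 + k2 + k6) ∷ (1 + k1 + k5) ∷ (1 + k5 + k6) ∷ (1 + k4 + k5) ∷ (1 + k3 + k4) ∷ (1 + k3 + k6) ∷ []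

expr≡label : ∀ t k → expr t k ≡ label t k
expr≡label t (k1 ∷ k2 ∷ k3 ∷ k4 ∷ k5 ∷ k6 ∷ []) with t
... | t1 = combination _ α₁ α₂ α₃ α₄ α₅ α₆ k1 k2 k3 k4 k5 k6
... | t2 = combination _ α₁ α₂ α₃ α₅ α₆ α₇ k1 k2 k3 k4 k5 k6
... | t31 = combination _ α₂ α₃ α₄ α₆ α₇ α₉ k1 k2 k3 k4 k5 k6
... | t32 = combination _ α₁ α₃ α₄ α₆ α₇ α₉ k1 k2 k3 k4 k5 k6
... | t33 = combination _ α₁ α₂ α₄ α₆ α₇ α₈ k1 k2 k3 k4 k5 k6
... | t34 = combination _ α₁ α₂ α₃ α₄ α₇ α₈ k1 k2 k3 k4 k5 k6
... | t351 = combination _ α₁ α₂ α₃ α₄ α₆ α₇ k1 k2 k3 k4 k5 k6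
... | t352 = combination _ α₁ α₂ α₃ α₄ α₆ α₇ k1 k2 k3 k4 k5 k6

-- Recovering the type and the coefficients

-- Together with `choose-yes` and `choose-no` this settles a test on symbolic labels by a proof,
-- without evaluating the decision procedure.
choose : ∀ {P : Set} → Dec P → Type → Type → Type
choose (yes _) t t' = t
choose (no _) t t' = t'

choose-yes : ∀ {P : Set} (d : Dec P) {s t t'} → P → t ≡ s → choose d t t' ≡ s
choose-yes (yes _) _ eq = eq
choose-yes (no ¬p) p _ = contradiction p ¬p

choose-no : ∀ {P : Set} (d : Dec P) {s t t'} → ¬ P → t' ≡ s → choose d t t' ≡ s
choose-no (yes p) ¬p _ = contradiction p ¬p
choose-no (no _) _ eq = eq

-- Named after the coordinates p, q, r, s, u, v above: for instance x5 + x3 < x12 says v < −2p,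
-- x6 + x11 ≤ x1 says v ≥ 2u, and EvenV is meant for v ≤ 0, where x7 + x12 ∸ x1 is −v.
V≥0⊎V≥2U U≥0 V<-2minPQ P≤Q V<-2minRS S≤R EvenV : Labelling → Set
V≥0⊎V≥2U (x1 ∷ _ ∷ _ ∷ _ ∷ _ ∷ x6 ∷ x7 ∷ _ ∷ _ ∷ _ ∷ x11 ∷ x12 ∷ []) = x7 + x12 ≤ x1 ⊎ x6 + x11 ≤ x1
U≥0 (_ ∷ x2 ∷ x3 ∷ _ ∷ _ ∷ _ ∷ _ ∷ _ ∷ _ ∷ _ ∷ _ ∷ _ ∷ []) = x3 ≤ x2
V<-2minPQ (x1 ∷ _ ∷ x3 ∷ _ ∷ x5 ∷ _ ∷ x7 ∷ _ ∷ _ ∷ _ ∷ _ ∷ x12 ∷ []) = x5 + x3 < x12 ⊎ x1 + x7 < x12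
P≤Q (_ ∷ _ ∷ x3 ∷ _ ∷ _ ∷ _ ∷ x7 ∷ _ ∷ _ ∷ _ ∷ _ ∷ _ ∷ []) = x3 ≤ x7
V<-2minRS (_ ∷ _ ∷ x3 ∷ _ ∷ x5 ∷ _ ∷ _ ∷ x8 ∷ x9 ∷ _ ∷ _ ∷ x12 ∷ []) = x8 + x9 < x3 ⊎ x5 + x12 < x3
S≤R (_ ∷ _ ∷ _ ∷ _ ∷ _ ∷ _ ∷ _ ∷ _ ∷ x9 ∷ _ ∷ _ ∷ x12 ∷ []) = x9 ≤ x12
EvenV (x1 ∷ _ ∷ _ ∷ _ ∷ _ ∷ _ ∷ x7 ∷ _ ∷ _ ∷ _ ∷ _ ∷ x12 ∷ []) = 2 ∣ (x7 + x12 ∸ x1)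

V≥0⊎V≥2U? : ∀ α → Dec (V≥0⊎V≥2U α)
V≥0⊎V≥2U? (x1 ∷ _ ∷ _ ∷ _ ∷ _ ∷ x6 ∷ x7 ∷ _ ∷ _ ∷ _ ∷ x11 ∷ x12 ∷ []) = (x7 + x12 ≤? x1) ⊎-dec (x6 + x11 ≤? x1)

U≥0? : ∀ α → Dec (U≥0 α)
U≥0? (_ ∷ x2 ∷ x3 ∷ _ ∷ _ ∷ _ ∷ _ ∷ _ ∷ _ ∷ _ ∷ _ ∷ _ ∷ []) = x3 ≤? x2

V<-2minPQ? : ∀ α → Dec (V<-2minPQ α)
V<-2minPQ? (x1 ∷ _ ∷ x3 ∷ _ ∷ x5 ∷ _ ∷ x7 ∷ _ ∷ _ ∷ _ ∷ _ ∷ x12 ∷ []) = (x5 + x3 <? x12) ⊎-dec (x1 + x7 <? x12)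

P≤Q? : ∀ α → Dec (P≤Q α)
P≤Q? (_ ∷ _ ∷ x3 ∷ _ ∷ _ ∷ _ ∷ x7 ∷ _ ∷ _ ∷ _ ∷ _ ∷ _ ∷ []) = x3 ≤? x7

V<-2minRS? : ∀ α → Dec (V<-2minRS α)
V<-2minRS? (_ ∷ _ ∷ x3 ∷ _ ∷ x5 ∷ _ ∷ _ ∷ x8 ∷ x9 ∷ _ ∷ _ ∷ x12 ∷ []) = (x8 + x9 <? x3) ⊎-dec (x5 + x12 <? x3)

S≤R? : ∀ α → Dec (S≤R α)
S≤R? (_ ∷ _ ∷ _ ∷ _ ∷ _ ∷ _ ∷ _ ∷ _ ∷ x9 ∷ _ ∷ _ ∷ x12 ∷ []) = x9 ≤? x12

EvenV? : ∀ α → Dec (EvenV α)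
EvenV? (x1 ∷ _ ∷ _ ∷ _ ∷ _ ∷ _ ∷ x7 ∷ _ ∷ _ ∷ _ ∷ _ ∷ x12 ∷ []) = 2 ∣? (x7 + x12 ∸ x1)

-- On magic labellings the first test says v ≥ min(0, 2u), and the sign of u then separates `t1`
-- from `t2`. Parity is tested only once v < 0, where the truncated difference in `EvenV` really is
-- -v.
typeOf : Labelling → Type
typeOf α =
  choose (V≥0⊎V≥2U? α) (choose (U≥0? α) t1 t2)
  (choose (V<-2minPQ? α) (choose (P≤Q? α) t31 t32)
  (choose (V<-2minRS? α) (choose (S≤R? α) t34 t33)
  (choose (EvenV? α) t351 t352)))

-- The slack in each test is a sum of coefficients and constants. In `t31` to `t34`, k6 + 1 is the
-- amount by which v lies below -2 min(p, q) or -2 min(r, s).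
typeOf-label : ∀ t k → typeOf (label t k) ≡ t
typeOf-label t1 k@(k1 ∷ k2 ∷ k3 ∷ k4 ∷ k5 ∷ k6 ∷ []) =
  choose-yes (V≥0⊎V≥2U? (label t1 k)) (inj₁ (m≤m+n (k2 + k3) k5))
    (choose-yes (U≥0? (label t1 k)) (m≤m+n k1 k4) refl)
typeOf-label t2 k@(k1 ∷ k2 ∷ k3 ∷ k4 ∷ k5 ∷ k6 ∷ []) =
  choose-yes (V≥0⊎V≥2U? (label t2 k)) (inj₂ (m≤m+n (k2 + k3) k4))
    (choose-no (U≥0? (label t2 k)) (λ le → ≤-absurd le k6 refl) refl)
typeOf-label t31 k@(k1 ∷ k2 ∷ k3 ∷ k4 ∷ k5 ∷ k6 ∷ []) =
  choose-no (V≥0⊎V≥2U? (label t31 k))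
    [ (λ le → ≤-absurd le (k5 + k5 + k6) (solve (toList k)))
    , (λ le → ≤-absurd le (k3 + k3 + k6) (solve (toList k))) ]′
  (choose-yes (V<-2minPQ? (label t31 k)) (inj₁ (≤-by k6 (solve (toList k))))
    (choose-yes (P≤Q? (label t31 k)) (m≤n+m k5 k1) refl))
typeOf-label t32 k@(k1 ∷ k2 ∷ k3 ∷ k4 ∷ k5 ∷ k6 ∷ []) =
  choose-no (V≥0⊎V≥2U? (label t32 k))
    [ (λ le → ≤-absurd le (k5 + k5 + k6) (solve (toList k)))
    , (λ le → ≤-absurd le (k3 + k3 + k6) (solve (toList k))) ]′
  (choose-yes (V<-2minPQ? (label t32 k)) (inj₂ (≤-by k6 (solve (toList k))))
    (choose-no (P≤Q? (label t32 k)) (λ le → ≤-absurd le k1 (solve (toList k))) refl))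
typeOf-label t33 k@(k1 ∷ k2 ∷ k3 ∷ k4 ∷ k5 ∷ k6 ∷ []) =
  choose-no (V≥0⊎V≥2U? (label t33 k))
    [ (λ le → ≤-absurd le (k5 + k5 + k6) (solve (toList k)))
    , (λ le → ≤-absurd le (k3 + k3 + k6) (solve (toList k))) ]′
  (choose-no (V<-2minPQ? (label t33 k))
    [ (λ le → ≤-absurd le (1 + k1 + k1 + k6) (solve (toList k)))
    , (λ le → ≤-absurd le (1 + k2 + k2 + k6) (solve (toList k))) ]′
  (choose-yes (V<-2minRS? (label t33 k)) (inj₂ (≤-by k6 (solve (toList k))))
    (choose-no (S≤R? (label t33 k)) (λ le → ≤-absurd le k4 (solve (toList k))) refl)))
typeOf-label t34 k@(k1 ∷ k2 ∷ k3 ∷ k4 ∷ k5 ∷ k6 ∷ []) =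
  choose-no (V≥0⊎V≥2U? (label t34 k))
    [ (λ le → ≤-absurd le (k5 + k5 + k6) (solve (toList k)))
    , (λ le → ≤-absurd le (k4 + k4 + k6) (solve (toList k))) ]′
  (choose-no (V<-2minPQ? (label t34 k))
    [ (λ le → ≤-absurd le (1 + k1 + k1 + k6) (solve (toList k)))
    , (λ le → ≤-absurd le (1 + k2 + k2 + k6) (solve (toList k))) ]′
  (choose-yes (V<-2minRS? (label t34 k)) (inj₁ (≤-by k6 (solve (toList k))))
    (choose-yes (S≤R? (label t34 k)) (m≤n+m k5 k3) refl)))
typeOf-label t351 k@(k1 ∷ k2 ∷ k3 ∷ k4 ∷ k5 ∷ k6 ∷ []) =
  choose-no (V≥0⊎V≥2U? (label t351 k))
    [ (λ le → ≤-absurd le (1 + k6 + k6) (solve (toList k)))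
    , (λ le → ≤-absurd le (1 + k4 + k4) (solve (toList k))) ]′
  (choose-no (V<-2minPQ? (label t351 k))
    [ (λ le → ≤-absurd le (k1 + k1) (solve (toList k)))
    , (λ le → ≤-absurd le (k2 + k2) (solve (toList k))) ]′
  (choose-no (V<-2minRS? (label t351 k))
    [ (λ le → ≤-absurd le (k5 + k5) (solve (toList k)))
    , (λ le → ≤-absurd le (k3 + k3) (solve (toList k))) ]′
  (choose-yes (EvenV? (label t351 k)) (divides (1 + k6) (∸-by (k2 + k3) (solve (toList k)))) refl)))
typeOf-label t352 k@(k1 ∷ k2 ∷ k3 ∷ k4 ∷ k5 ∷ k6 ∷ []) =
  choose-no (V≥0⊎V≥2U? (label t352 k))
    [ (λ le → ≤-absurd le (k6 + k6) (solve (toList k)))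
    , (λ le → ≤-absurd le (k4 + k4) (solve (toList k))) ]′
  (choose-no (V<-2minPQ? (label t352 k))
    [ (λ le → ≤-absurd le (1 + k1 + k1) (solve (toList k)))
    , (λ le → ≤-absurd le (1 + k2 + k2) (solve (toList k))) ]′
  (choose-no (V<-2minRS? (label t352 k))
    [ (λ le → ≤-absurd le (1 + k5 + k5) (solve (toList k)))
    , (λ le → ≤-absurd le (1 + k3 + k3) (solve (toList k))) ]′
  (choose-no (EvenV? (label t352 k)) odd refl)))
  where
  odd : ¬ 2 ∣ (1 + k2 + k6 + (1 + k3 + k6) ∸ (1 + k2 + k3))
  -- Here -v = 2 k6 + 1, so 2 would divide the remainder 1.
  odd 2∣w rewrite ∸-by {1 + k2 + k6 + (1 + k3 + k6)} (1 + k2 + k3) {k6 * 2 + 1} (solve (toList k)) =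
    contradiction (∣1⇒≡1 (∣m+n∣m⇒∣n 2∣w (divides k6 refl))) λ ()

-- In types t351 and t352 the number m is k₆ + 1 = ⌈ −v / 2 ⌉.
coefficients₃₅ : ℕ → Labelling → Vec ℕ 6
coefficients₃₅ m (x1 ∷ x2 ∷ x3 ∷ x4 ∷ x5 ∷ x6 ∷ x7 ∷ x8 ∷ x9 ∷ x10 ∷ x11 ∷ x12 ∷ []) =
  x3 ∸ m ∷ x7 ∸ m ∷ x12 ∸ m ∷ x2 ∸ suc (x3 ∸ m) ∷ x9 ∸ m ∷ m ∸ 1 ∷ []

-- A left inverse of `label t`; the truncated subtractions are exact on labels of type `t`, and
-- nothing is claimed elsewhere.
coefficients : Type → Labelling → Vec ℕ 6
coefficients t α@(x1 ∷ x2 ∷ x3 ∷ x4 ∷ x5 ∷ x6 ∷ x7 ∷ x8 ∷ x9 ∷ x10 ∷ x11 ∷ x12 ∷ []) with t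
... | t1 = x3 ∷ x7 ∷ x12 ∷ x2 ∸ x3 ∷ x1 ∸ (x7 + x12) ∷ x9 ∷ []
... | t2 = x2 ∷ x6 ∷ x11 ∷ x1 ∸ (x6 + x11) ∷ x10 ∷ x3 ∸ suc x2 ∷ []
... | t31 = x7 ∸ x3 ∷ x5 ∷ x2 ∷ x8 ∷ x3 ∷ x12 ∸ suc (x5 + x3) ∷ []
... | t32 = x3 ∸ suc x7 ∷ x1 ∷ x6 ∷ x4 ∷ x7 ∷ x12 ∸ suc (x1 + x7) ∷ []
... | t33 = x5 ∷ x1 ∷ x11 ∷ x9 ∸ suc x12 ∷ x12 ∷ x3 ∸ suc (x5 + x12) ∷ []
... | t34 = x8 ∷ x4 ∷ x12 ∸ x9 ∷ x10 ∷ x9 ∷ x3 ∸ suc (x8 + x9) ∷ []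
... | t351 = coefficients₃₅ ⌊ x7 + x12 ∸ x1 /2⌋ α
... | t352 = coefficients₃₅ ⌊ suc (x7 + x12 ∸ x1) /2⌋ α

vec₆ : ∀ {a b c d e f a' b' c' d' e' f' : ℕ} →
  a ≡ a' → b ≡ b' → c ≡ c' → d ≡ d' → e ≡ e' → f ≡ f' →
  _≡_ {A = Vec ℕ 6} (a ∷ b ∷ c ∷ d ∷ e ∷ f ∷ []) (a' ∷ b' ∷ c' ∷ d' ∷ e' ∷ f' ∷ [])
vec₆ refl refl refl refl refl refl = refl

coefficients-label : ∀ t k → coefficients t (label t k) ≡ k
coefficients-label t1 k@(k1 ∷ k2 ∷ k3 ∷ k4 ∷ k5 ∷ k6 ∷ []) =
  vec₆ refl refl refl (∸-by k1 refl) (∸-by (k2 + k3) refl) refl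
coefficients-label t2 k@(k1 ∷ k2 ∷ k3 ∷ k4 ∷ k5 ∷ k6 ∷ []) =
  vec₆ refl refl refl (∸-by (k2 + k3) refl) refl (∸-by (suc k1) refl)
coefficients-label t31 k@(k1 ∷ k2 ∷ k3 ∷ k4 ∷ k5 ∷ k6 ∷ []) =
  vec₆ (m+n∸n≡m k1 k5) refl refl refl refl (∸-by (suc (k2 + k5)) refl)
coefficients-label t32 k@(k1 ∷ k2 ∷ k3 ∷ k4 ∷ k5 ∷ k6 ∷ []) =
  vec₆ (m+n∸n≡m k1 k5) refl refl refl refl (∸-by (suc (k2 + k5)) refl)
coefficients-label t33 k@(k1 ∷ k2 ∷ k3 ∷ k4 ∷ k5 ∷ k6 ∷ []) =
  vec₆ refl refl refl (m+n∸n≡m k4 k5) refl (∸-by (suc (k1 + k5)) refl)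
coefficients-label t34 k@(k1 ∷ k2 ∷ k3 ∷ k4 ∷ k5 ∷ k6 ∷ []) =
  vec₆ refl refl (m+n∸n≡m k3 k5) refl refl (∸-by (suc (k1 + k5)) refl)
coefficients-label t351 k@(k1 ∷ k2 ∷ k3 ∷ k4 ∷ k5 ∷ k6 ∷ []) = trans
  (cong (λ m → coefficients₃₅ m (label t351 k))
    (trans (cong ⌊_/2⌋ (∸-by (k2 + k3) {suc k6 + suc k6} (solve (toList k)))) (sym (n≡⌊n+n/2⌋ (suc k6)))))
  (vec₆ (m+n∸n≡m k1 k6) (m+n∸n≡m k2 k6) (m+n∸n≡m k3 k6)
    (trans (cong (k1 + k4 ∸_) (m+n∸n≡m k1 k6)) (m+n∸m≡n k1 k4)) (m+n∸n≡m k5 k6) refl)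
coefficients-label t352 k@(k1 ∷ k2 ∷ k3 ∷ k4 ∷ k5 ∷ k6 ∷ []) = trans
  (cong (λ m → coefficients₃₅ m (label t352 k))
    -- One successor on each side of the difference cancels by computation. The result k6 + suc k6
    -- is odd, and the extra `suc` rounds its half up.
    (trans (cong (λ w → ⌊ suc w /2⌋) (∸-by (k2 + k3) {k6 + suc k6} (solve (toList k)))) (sym (n≡⌊n+n/2⌋ (suc k6)))))
  (vec₆ (m+n∸n≡m k1 k6) (m+n∸n≡m k2 k6) (m+n∸n≡m k3 k6)
    (trans (cong (k1 + k4 ∸_) (m+n∸n≡m k1 k6)) (m+n∸m≡n k1 k4)) (m+n∸n≡m k5 k6) refl)

-- `typeOf` recovers the type from the labels; once the types are identified, the same left inverse
-- `coefficients t` applies to both sides.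
expr-unique : ∀ t k t' k' → expr t k ≡ expr t' k' → (t' ≡ t) × (k' ≡ k)
expr-unique t k t' k' eq = go types-agree
  where
  labels-agree : label t' k' ≡ label t k
  labels-agree = trans (sym (expr≡label t' k')) (trans (sym eq) (expr≡label t k))

  types-agree : t' ≡ t
  types-agree = trans (sym (typeOf-label t' k')) (trans (cong typeOf labels-agree) (typeOf-label t k))

  go : t' ≡ t → (t' ≡ t) × (k' ≡ k)
  go refl = refl ,
    trans (sym (coefficients-label t k')) (trans (cong (coefficients t) labels-agree) (coefficients-label t k))

-- Balanced labellings

-- The equations of the magic property with the magic sum eliminated.
Balanced : Labelling → Set
Balanced (x1 ∷ x2 ∷ x3 ∷ x4 ∷ x5 ∷ x6 ∷ x7 ∷ x8 ∷ x9 ∷ x10 ∷ x11 ∷ x12 ∷ []) =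
  (x6 + x3 ≡ x2 + x7) × (x10 + x3 ≡ x2 + x9) × (x11 + x3 ≡ x2 + x12) ×
  (x5 + x7 ≡ x1 + x3) × (x4 + x12 ≡ x1 + x9) × (x8 + x7 ≡ x4 + x3)

-- The magic sum cancels in the difference of two vertex equations, or, for the first equation, of
-- two pairs of them.
magic⇒balanced : ∀ α → IsMagic α → Balanced α
magic⇒balanced α@(x1 ∷ x2 ∷ x3 ∷ x4 ∷ x5 ∷ x6 ∷ x7 ∷ x8 ∷ x9 ∷ x10 ∷ x11 ∷ x12 ∷ [])
  (r , h1 , h2 , h3 , h4 , h5 , h6 , h7 , h8) =
  ≡-by (trans (h1 ⊞ h6) (sym (h2 ⊞ h5))) (solve (toList α)) ,
  ≡-by (trans h1 (sym h2)) (solve (toList α)) ,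
  ≡-by (trans h3 (sym h4)) (solve (toList α)) ,
  ≡-by (trans h2 (sym h6)) (solve (toList α)) ,
  ≡-by (trans h1 (sym h3)) (solve (toList α)) ,
  ≡-by (trans h4 (sym h8)) (solve (toList α))

balanced-⊕ : ∀ α β → Balanced α → Balanced β → Balanced (α ⊕ β)
balanced-⊕ (x1 ∷ x2 ∷ x3 ∷ x4 ∷ x5 ∷ x6 ∷ x7 ∷ x8 ∷ x9 ∷ x10 ∷ x11 ∷ x12 ∷ [])
  (y1 ∷ y2 ∷ y3 ∷ y4 ∷ y5 ∷ y6 ∷ y7 ∷ y8 ∷ y9 ∷ y10 ∷ y11 ∷ y12 ∷ [])
  (a6 , a10 , a11 , a5 , a4 , a8) (b6 , b10 , b11 , b5 , b4 , b8) =
  add x6 x3 x2 x7 y6 y3 y2 y7 a6 b6 ,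
  add x10 x3 x2 x9 y10 y3 y2 y9 a10 b10 ,
  add x11 x3 x2 x12 y11 y3 y2 y12 a11 b11 ,
  add x5 x7 x1 x3 y5 y7 y1 y3 a5 b5 ,
  add x4 x12 x1 x9 y4 y12 y1 y9 a4 b4 ,
  add x8 x7 x4 x3 y8 y7 y4 y3 a8 b8
  where
  add : ∀ a b c d a' b' c' d' → a + b ≡ c + d → a' + b' ≡ c' + d' → (a + a') + (b + b') ≡ (c + c') + (d + d')
  add a b c d a' b' c' d' eq eq' =
    ≡-by (sym (eq ⊞ eq')) (solve (toList (a ∷ b ∷ c ∷ d ∷ a' ∷ b' ∷ c' ∷ d' ∷ [])))

balanced-⊙ : ∀ k α → Balanced α → Balanced (k ⊙ α)
balanced-⊙ k (x1 ∷ x2 ∷ x3 ∷ x4 ∷ x5 ∷ x6 ∷ x7 ∷ x8 ∷ x9 ∷ x10 ∷ x11 ∷ x12 ∷ [])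
  (a6 , a10 , a11 , a5 , a4 , a8) =
  mul x6 x3 x2 x7 a6 ,
  mul x10 x3 x2 x9 a10 ,
  mul x11 x3 x2 x12 a11 ,
  mul x5 x7 x1 x3 a5 ,
  mul x4 x12 x1 x9 a4 ,
  mul x8 x7 x4 x3 a8
  where
  mul : ∀ a b c d → a + b ≡ c + d → k * a + k * b ≡ k * c + k * d
  mul a b c d eq = trans (sym (*-distribˡ-+ k a b)) (trans (cong (k *_) eq) (*-distribˡ-+ k c d))

pattern bal = refl , refl , refl , refl , refl , refl

combination-balanced : ∀ {b g1 g2 g3 g4 g5 g6} k1 k2 k3 k4 k5 k6 → Balanced b →
  Balanced g1 → Balanced g2 → Balanced g3 → Balanced g4 → Balanced g5 → Balanced g6 →
  Balanced (b ⊕ k1 ⊙ g1 ⊕ k2 ⊙ g2 ⊕ k3 ⊙ g3 ⊕ k4 ⊙ g4 ⊕ k5 ⊙ g5 ⊕ k6 ⊙ g6)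
combination-balanced k1 k2 k3 k4 k5 k6 b g1 g2 g3 g4 g5 g6 =
  step k6 g6 (step k5 g5 (step k4 g4 (step k3 g3 (step k2 g2 (step k1 g1 b)))))
  where
  step : ∀ {v g} k → Balanced g → Balanced v → Balanced (v ⊕ k ⊙ g)
  step {v} {g} k bg bv = balanced-⊕ v (k ⊙ g) bv (balanced-⊙ k g bg)

-- Balance is a linear condition, so it suffices to check the base and the generators, where it
-- holds by computation.
balanced-expr : ∀ t k → Balanced (expr t k)
balanced-expr t (k1 ∷ k2 ∷ k3 ∷ k4 ∷ k5 ∷ k6 ∷ []) with t
... | t1 = combination-balanced {base t1} {α₁} {α₂} {α₃} {α₄} {α₅} {α₆}
    k1 k2 k3 k4 k5 k6 bal bal bal bal bal bal bal
... | t2 = combination-balanced {base t2} {α₁} {α₂} {α₃} {α₅} {α₆} {α₇}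
    k1 k2 k3 k4 k5 k6 bal bal bal bal bal bal bal
... | t31 = combination-balanced {base t31} {α₂} {α₃} {α₄} {α₆} {α₇} {α₉}
    k1 k2 k3 k4 k5 k6 bal bal bal bal bal bal bal
... | t32 = combination-balanced {base t32} {α₁} {α₃} {α₄} {α₆} {α₇} {α₉}
    k1 k2 k3 k4 k5 k6 bal bal bal bal bal bal bal
... | t33 = combination-balanced {base t33} {α₁} {α₂} {α₄} {α₆} {α₇} {α₈}
    k1 k2 k3 k4 k5 k6 bal bal bal bal bal bal bal
... | t34 = combination-balanced {base t34} {α₁} {α₂} {α₃} {α₄} {α₇} {α₈}
    k1 k2 k3 k4 k5 k6 bal bal bal bal bal bal bal
... | t351 = combination-balanced {base t351} {α₁} {α₂} {α₃} {α₄} {α₆} {α₇}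
    k1 k2 k3 k4 k5 k6 bal bal bal bal bal bal bal
... | t352 = combination-balanced {base t352} {α₁} {α₂} {α₃} {α₄} {α₆} {α₇}
    k1 k2 k3 k4 k5 k6 bal bal bal bal bal bal bal

-- These six labels carry the coordinates: `x3`, `x7`, `x12`, `x9` are p, q, r, s, while `x2` fixes
-- u and `x1` fixes v.
Agree : Labelling → Labelling → Set
Agree (x1 ∷ x2 ∷ x3 ∷ _ ∷ _ ∷ _ ∷ x7 ∷ _ ∷ x9 ∷ _ ∷ _ ∷ x12 ∷ [])
      (y1 ∷ y2 ∷ y3 ∷ _ ∷ _ ∷ _ ∷ y7 ∷ _ ∷ y9 ∷ _ ∷ _ ∷ y12 ∷ []) =
  (x1 ≡ y1) × (x2 ≡ y2) × (x3 ≡ y3) × (x7 ≡ y7) × (x9 ≡ y9) × (x12 ≡ y12)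

-- Each equation yields one further label by cancellation; `x8` comes last because its equation
-- involves `x4`.
balanced-determined : ∀ α β → Balanced α → Balanced β → Agree α β → α ≡ β
balanced-determined
  (x1 ∷ x2 ∷ x3 ∷ x4 ∷ x5 ∷ x6 ∷ x7 ∷ x8 ∷ x9 ∷ x10 ∷ x11 ∷ x12 ∷ [])
  (_ ∷ _ ∷ _ ∷ y4 ∷ y5 ∷ y6 ∷ _ ∷ y8 ∷ _ ∷ y10 ∷ y11 ∷ _ ∷ [])
  (a6 , a10 , a11 , a5 , a4 , a8) (b6 , b10 , b11 , b5 , b4 , b8)
  (refl , refl , refl , refl , refl , refl)
  with refl ← +-cancelʳ-≡ x3 x6 y6 (trans a6 (sym b6))
     | refl ← +-cancelʳ-≡ x3 x10 y10 (trans a10 (sym b10))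
     | refl ← +-cancelʳ-≡ x3 x11 y11 (trans a11 (sym b11))
     | refl ← +-cancelʳ-≡ x7 x5 y5 (trans a5 (sym b5))
     | refl ← +-cancelʳ-≡ x12 x4 y4 (trans a4 (sym b4))
  with refl ← +-cancelʳ-≡ x7 x8 y8 (trans a8 (sym b8)) = refl

-- Existence

-- The equation says a - d = c - b, and the right side is nonnegative.
≤-transfer : ∀ {a b c d} → a + b ≡ c + d → b ≤ c → d ≤ a
≤-transfer {a} {b} {c} {d} eq b≤c = +-cancelˡ-≤ c d a
  (subst (_≤ c + a) eq (subst (a + b ≤_) (+-comm a c) (+-monoʳ-≤ a b≤c)))

module _ (x1 x2 x3 x4 x5 x6 x7 x8 x9 x10 x11 x12 : ℕ) where

  private
    α : Labelling
    α = x1 ∷ x2 ∷ x3 ∷ x4 ∷ x5 ∷ x6 ∷ x7 ∷ x8 ∷ x9 ∷ x10 ∷ x11 ∷ x12 ∷ []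

  Decomposition : Set
  Decomposition = ∃₂ λ t k → α ≡ expr t k

  module _ (balanced : Balanced α) where

    private
      e6 : x6 + x3 ≡ x2 + x7
      e6 = let e , _ = balanced in e

      e10 : x10 + x3 ≡ x2 + x9
      e10 = let _ , e , _ = balanced in e

      e11 : x11 + x3 ≡ x2 + x12
      e11 = let _ , _ , e , _ = balanced in e

      e5 : x5 + x7 ≡ x1 + x3
      e5 = let _ , _ , _ , e , _ = balanced in e

      e4 : x4 + x12 ≡ x1 + x9
      e4 = let _ , _ , _ , _ , e , _ = balanced in e

      e8 : x8 + x7 ≡ x4 + x3
      e8 = let _ , _ , _ , _ , _ , e = balanced in e

    -- Both sides are balanced, so only the six labels in `Agree` have to be compared.
    decomposition : ∀ t k → Agree α (label t k) → Decomposition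
    decomposition t k agree = t , k , trans
      (balanced-determined α (label t k) balanced (subst Balanced (expr≡label t k) (balanced-expr t k)) agree)
      (sym (expr≡label t k))

    -- The coefficients are the coordinates p, q, r, u, v, s themselves.
    decompose-t1 : x3 ≤ x2 → x7 + x12 ≤ x1 → Decomposition
    decompose-t1 x3≤x2 x7+x12≤x1
      with u , hu ← m≤n⇒∃[o]m+o≡n x3≤x2 | v , hv ← m≤n⇒∃[o]m+o≡n x7+x12≤x1 =
      decomposition t1 (x3 ∷ x7 ∷ x12 ∷ u ∷ v ∷ x9 ∷ [])
        ( sym hv
        , sym hu
        , refl
        , refl
        , refl
        , refl )

    -- The coefficients are p + u, q + u, r + u, v - 2u, s + u and -u - 1; the base `α₇` accounts
    -- for the missing unit of -u.
    decompose-t2 : x2 < x3 → x6 + x11 ≤ x1 → Decomposition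
    decompose-t2 x2<x3 x6+x11≤x1
      with n , hn ← m≤n⇒∃[o]m+o≡n x2<x3 | d , hd ← m≤n⇒∃[o]m+o≡n x6+x11≤x1 =
      decomposition t2 (x2 ∷ x6 ∷ x11 ∷ d ∷ x10 ∷ n ∷ [])
        ( sym hd
        , refl
        , sym hn
        , ≡-by (e6 ⊞ hn) (solve (toList (n ∷ α)))
        , ≡-by (e10 ⊞ hn) (solve (toList (n ∷ α)))
        , ≡-by (e11 ⊞ hn) (solve (toList (n ∷ α))) )

    -- Here w is −v.
    module _ (w : ℕ) (hw : x7 + x12 ≡ x1 + w) where

      -- In `t31` to `t34`, `d` is the gap between the two compared coordinates, less 1 if the
      -- comparison is strict, and `n` is w - 1 minus twice the smaller one. The other coefficients
      -- are labels.
      decompose-t31 : x3 ≤ x7 → x3 + x3 < w → Decomposition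
      decompose-t31 x3≤x7 2x3<w
        with d , hd ← m≤n⇒∃[o]m+o≡n x3≤x7 | n , hn ← m≤n⇒∃[o]m+o≡n 2x3<w =
        decomposition t31 (d ∷ x5 ∷ x2 ∷ x8 ∷ x3 ∷ n ∷ [])
          ( ≡-by (e5 ⊞ hd) (solve (toList (d ∷ α)))
          , refl
          , refl
          , ≡-by hd (solve (toList (d ∷ α)))
          , ≡-by (sym hw ⊞ hn ⊞ e4 ⊞ e8) (solve (toList (n ∷ w ∷ α)))
          , ≡-by (sym hw ⊞ hn ⊞ e5) (solve (toList (n ∷ w ∷ α))) )

      decompose-t32 : x7 < x3 → x7 + x7 < w → Decomposition
      decompose-t32 x7<x3 2x7<w
        with d , hd ← m≤n⇒∃[o]m+o≡n x7<x3 | n , hn ← m≤n⇒∃[o]m+o≡n 2x7<w =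
        decomposition t32 (d ∷ x1 ∷ x6 ∷ x4 ∷ x7 ∷ n ∷ [])
          ( refl
          , ≡-by (e6 ⊞ hd) (solve (toList (d ∷ α)))
          , ≡-by hd (solve (toList (d ∷ α)))
          , refl
          , ≡-by (sym hw ⊞ hn ⊞ e4) (solve (toList (n ∷ w ∷ α)))
          , ≡-by (sym hw ⊞ hn) (solve (toList (n ∷ w ∷ α))) )

      decompose-t33 : x12 < x9 → x12 + x12 < w → Decomposition
      decompose-t33 x12<x9 2x12<w
        with d , hd ← m≤n⇒∃[o]m+o≡n x12<x9 | n , hn ← m≤n⇒∃[o]m+o≡n 2x12<w =
        decomposition t33 (x5 ∷ x1 ∷ x11 ∷ d ∷ x12 ∷ n ∷ [])
          ( refl
          , ≡-by (sym hw ⊞ hn ⊞ e5 ⊞ e11) (solve (toList (n ∷ w ∷ α)))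
          , ≡-by (sym hw ⊞ hn ⊞ e5) (solve (toList (n ∷ w ∷ α)))
          , ≡-by (sym hw ⊞ hn) (solve (toList (n ∷ w ∷ α)))
          , ≡-by hd (solve (toList (d ∷ α)))
          , refl )

      decompose-t34 : x9 ≤ x12 → x9 + x9 < w → Decomposition
      decompose-t34 x9≤x12 2x9<w
        with d , hd ← m≤n⇒∃[o]m+o≡n x9≤x12 | n , hn ← m≤n⇒∃[o]m+o≡n 2x9<w =
        decomposition t34 (x8 ∷ x4 ∷ d ∷ x10 ∷ x9 ∷ n ∷ [])
          ( ≡-by (e4 ⊞ hd) (solve (toList (d ∷ α)))
          , ≡-by (sym hw ⊞ hn ⊞ e4 ⊞ e8 ⊞ e10) (solve (toList (n ∷ w ∷ α)))
          , ≡-by (sym hw ⊞ hn ⊞ e4 ⊞ e8) (solve (toList (n ∷ w ∷ α)))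
          , ≡-by (sym hw ⊞ hn ⊞ e4) (solve (toList (n ∷ w ∷ α)))
          , refl
          , ≡-by hd (solve (toList (d ∷ α))) )

      -- Unlike in `coefficients₃₅`, `m` is k6 itself, here and in `decompose-t352`. The bound on
      -- `x3` says that k4 = u + m is nonnegative; the other bounds do the same for p - m - 1, q - m
      -- - 1, r - m - 1 and s - m - 1.
      decompose-t351 : ∀ m → w ≡ suc m + suc m → x3 < x2 + suc m →
        m < x3 → m < x7 → m < x12 → m < x9 → Decomposition
      decompose-t351 m hm x3<x2+m m<x3 m<x7 m<x12 m<x9
        with k1 , h1 ← m≤n⇒∃[o]m+o≡n m<x3 | k2 , h2 ← m≤n⇒∃[o]m+o≡n m<x7
           | k3 , h3 ← m≤n⇒∃[o]m+o≡n m<x12 | k4 , h4 ← m≤n⇒∃[o]m+o≡n x3<x2+m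
           | k5 , h5 ← m≤n⇒∃[o]m+o≡n m<x9 =
        decomposition t351 (k1 ∷ k2 ∷ k3 ∷ k4 ∷ k5 ∷ m ∷ [])
          ( ≡-by (hw ⊞ h2 ⊞ h3 ⊞ hm) (solve (toList (m ∷ w ∷ k2 ∷ k3 ∷ α)))
          , ≡-by (h4 ⊞ h1) (solve (toList (m ∷ k1 ∷ k4 ∷ α)))
          , ≡-by h1 (solve (toList (m ∷ k1 ∷ α)))
          , ≡-by h2 (solve (toList (m ∷ k2 ∷ α)))
          , ≡-by h5 (solve (toList (m ∷ k5 ∷ α)))
          , ≡-by h3 (solve (toList (m ∷ k3 ∷ α))) )

      decompose-t352 : ∀ m → w ≡ suc (m + m) → x3 ≤ x2 + m →
        m < x3 → m < x7 → m < x12 → m < x9 → Decomposition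
      decompose-t352 m hm x3≤x2+m m<x3 m<x7 m<x12 m<x9
        with k1 , h1 ← m≤n⇒∃[o]m+o≡n m<x3 | k2 , h2 ← m≤n⇒∃[o]m+o≡n m<x7
           | k3 , h3 ← m≤n⇒∃[o]m+o≡n m<x12 | k4 , h4 ← m≤n⇒∃[o]m+o≡n x3≤x2+m
           | k5 , h5 ← m≤n⇒∃[o]m+o≡n m<x9 =
        decomposition t352 (k1 ∷ k2 ∷ k3 ∷ k4 ∷ k5 ∷ m ∷ [])
          ( ≡-by (hw ⊞ h2 ⊞ h3 ⊞ hm) (solve (toList (m ∷ w ∷ k2 ∷ k3 ∷ α)))
          , ≡-by (h4 ⊞ h1) (solve (toList (m ∷ k1 ∷ k4 ∷ α)))
          , ≡-by h1 (solve (toList (m ∷ k1 ∷ α)))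
          , ≡-by h2 (solve (toList (m ∷ k2 ∷ α)))
          , ≡-by h5 (solve (toList (m ∷ k5 ∷ α)))
          , ≡-by h3 (solve (toList (m ∷ k3 ∷ α))) )

      -- This is v < 2u.
      2x3<2x2+w : x1 < x6 + x11 → x3 + x3 < x2 + x2 + w
      2x3<2x2+w x1<x6+x11 = <-by (x3 + x3) (x2 + x2 + w) x1<x6+x11 (sym (e6 ⊞ e11 ⊞ hw)) (solve (toList (w ∷ α)))

      -- For w = 2m + 2 and for w = 2m + 1 alike, halving turns w ≤ 2x into m < x, and v < 2u into u
      -- + m ≥ 0.
      decompose-t35 : 0 < w → x1 < x6 + x11 →
        w ≤ x3 + x3 → w ≤ x7 + x7 → w ≤ x12 + x12 → w ≤ x9 + x9 → Decomposition
      decompose-t35 0<w x1<x6+x11 w≤2x3 w≤2x7 w≤2x12 w≤2x9 with even⊎odd w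
      ... | zero , inj₁ refl = contradiction 0<w λ ()
      ... | suc m , inj₁ hm = decompose-t351 m hm
        (half-< (<-by (x3 + x3) (x2 + suc m + (x2 + suc m)) (2x3<2x2+w x1<x6+x11) (sym hm) (solve (toList (m ∷ w ∷ α)))))
        (below w≤2x3) (below w≤2x7) (below w≤2x12) (below w≤2x9)
        where
        below : ∀ {x} → w ≤ x + x → m < x
        below {x} w≤2x = half-≤ (subst (_≤ x + x) hm w≤2x)
      ... | m , inj₂ hm = decompose-t352 m hm
        (half-≤ (s≤s⁻¹ (<-by (x3 + x3) (suc (x2 + m + (x2 + m))) (2x3<2x2+w x1<x6+x11) (sym hm) (solve (toList (m ∷ w ∷ α))))))
        (below w≤2x3) (below w≤2x7) (below w≤2x12) (below w≤2x9)
        where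
        below : ∀ {x} → w ≤ x + x → m < x
        below {x} w≤2x = half-< (subst (_≤ x + x) hm w≤2x)

      -- Comparing w with twice the smaller coordinate of a pair either lands in one of `t31` to
      -- `t34` or bounds w by twice each coordinate of the pair. Surviving both pairs gives the four
      -- bounds of `decompose-t35`.
      decompose-v<0 : 0 < w → x1 < x6 + x11 → Decomposition
      decompose-v<0 0<w x1<x6+x11 = split-pq (≤-<-connex x3 x7)
        where
        split-rs : w ≤ x3 + x3 → w ≤ x7 + x7 → x9 ≤ x12 ⊎ x12 < x9 → Decomposition
        split-rs w≤2x3 w≤2x7 (inj₁ x9≤x12) with ≤-<-connex w (x9 + x9)
        ... | inj₂ 2x9<w = decompose-t34 x9≤x12 2x9<w
        ... | inj₁ w≤2x9 = decompose-t35 0<w x1<x6+x11 w≤2x3 w≤2x7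
          (≤-trans w≤2x9 (+-mono-≤ x9≤x12 x9≤x12)) w≤2x9
        split-rs w≤2x3 w≤2x7 (inj₂ x12<x9) with ≤-<-connex w (x12 + x12)
        ... | inj₂ 2x12<w = decompose-t33 x12<x9 2x12<w
        ... | inj₁ w≤2x12 = decompose-t35 0<w x1<x6+x11 w≤2x3 w≤2x7
          w≤2x12 (≤-trans w≤2x12 (+-mono-≤ (<⇒≤ x12<x9) (<⇒≤ x12<x9)))

        split-pq : x3 ≤ x7 ⊎ x7 < x3 → Decomposition
        split-pq (inj₁ x3≤x7) with ≤-<-connex w (x3 + x3)
        ... | inj₂ 2x3<w = decompose-t31 x3≤x7 2x3<w
        ... | inj₁ w≤2x3 = split-rs w≤2x3 (≤-trans w≤2x3 (+-mono-≤ x3≤x7 x3≤x7)) (≤-<-connex x9 x12)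
        split-pq (inj₂ x7<x3) with ≤-<-connex w (x7 + x7)
        ... | inj₂ 2x7<w = decompose-t32 x7<x3 2x7<w
        ... | inj₁ w≤2x7 =
          split-rs (≤-trans w≤2x7 (+-mono-≤ (<⇒≤ x7<x3) (<⇒≤ x7<x3))) w≤2x7 (≤-<-connex x9 x12)

    decompose-t3 : x1 < x7 + x12 → x1 < x6 + x11 → Decomposition
    decompose-t3 x1<x7+x12 x1<x6+x11 with n , hn ← m≤n⇒∃[o]m+o≡n x1<x7+x12 =
      decompose-v<0 (suc n) (trans (sym hn) (sym (+-suc x1 n))) (s≤s z≤n) x1<x6+x11

    -- As q + u = `x6` and r + u = `x11`, v < 0 implies v < 2u when u ≥ 0, and conversely when u <
    -- 0. One comparison thus yields both hypotheses of `decompose-t3`.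
    decompose : Decomposition
    decompose with ≤-<-connex x3 x2
    ... | inj₁ x3≤x2 with ≤-<-connex (x7 + x12) x1
    ...   | inj₁ x7+x12≤x1 = decompose-t1 x3≤x2 x7+x12≤x1
    ...   | inj₂ x1<x7+x12 = decompose-t3 x1<x7+x12
      (<-≤-trans x1<x7+x12 (+-mono-≤ (≤-transfer e6 x3≤x2) (≤-transfer e11 x3≤x2)))
    decompose | inj₂ x2<x3 with ≤-<-connex (x6 + x11) x1
    ...   | inj₁ x6+x11≤x1 = decompose-t2 x2<x3 x6+x11≤x1
    ...   | inj₂ x1<x6+x11 = decompose-t3
      (<-≤-trans x1<x6+x11 (+-mono-≤ (u<0⇒≤ e6) (u<0⇒≤ e11))) x1<x6+x11
      where
      u<0⇒≤ : ∀ {a d} → a + x3 ≡ x2 + d → a ≤ d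
      u<0⇒≤ {a} {d} eq = ≤-transfer (trans (+-comm d x2) (trans (sym eq) (+-comm a x3))) (<⇒≤ x2<x3)

-- Existence and uniqueness combined

theorem1p1 : (α : Labelling) → IsMagic α →
    Σ Type λ t → Σ (Vec ℕ 6) λ k → (α ≡ expr t k) ×
    ((t' : Type) (k' : Vec ℕ 6) → α ≡ expr t' k' → (t' ≡ t) × (k' ≡ k))
theorem1p1 α@(x1 ∷ x2 ∷ x3 ∷ x4 ∷ x5 ∷ x6 ∷ x7 ∷ x8 ∷ x9 ∷ x10 ∷ x11 ∷ x12 ∷ []) magic
  with t , k , eq ← decompose x1 x2 x3 x4 x5 x6 x7 x8 x9 x10 x11 x12 (magic⇒balanced α magic) =
  t , k , eq , λ t' k' eq' → expr-unique t k t' k' (trans (sym eq) eq')
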